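{- Let $m\ge1$ and let $L_1,\ldots,L_m\in\mathit{Vect}(n)$ be differential operators of first order in $n$ variables. Then $$L_m\diamond \cdots\diamond L_1=\sum_{\pi\in \Pi(m)} L_{\pi}^\bullet,$$ where $\Pi(m)$ is the set of all set partitions of $[m]=\{1,\ldots,m\}$, and, for $\pi=\{A_1,\dots,A_k\}\in\Pi(m)$, $L_\pi^\bullet=L_{A_1}\bullet\cdots\bullet L_{A_k}$, with $L_A=(L_{i_s}\diamond\cdots\diamond L_{i_2})\circ L_{i_1}$ for a non-empty subset $A=\{i_1<i_2<\cdots<i_s\}\subseteq[m]$ (so $L_A=L_{i_1}$ if $s=1$).
   Context: Let $U$ be the coefficient algebra: a commutative associative unital $\mathbf{C}$-algebra of functions $u=u(x_1,\ldots,x_n)$ with the commuting $\mathbf{C}$-linear derivations $\partial_i=\partial/\partial x_i$, $i=1,\dots,n$ (only this differential-algebra structure is used; for example $U=\mathbf{C}[[x_1,\ldots,x_n]]$). For $\alpha=(\alpha_1,\dots,\alpha_n)\in\mathbf{Z}_0^n$ ($\mathbf{Z}_0$ = non-negative integers) put $\partial^\alpha=\prod_{i=1}^n\partial_i^{\alpha_i}$. $\mathit{Diff}_n$ is the space of differential operators, i.e. finite formal sums $\sum_{\alpha\in\mathbf{Z}_0^n}u_\alpha\partial^\alpha$ with $u_\alpha\in U$ (the free $U$-module on the symbols $\partial^\alpha$). $\mathit{Vect}(n)$ is the subspace of differential operators of first order, i.e. those of the form $\sum_{i=1}^n u_i\partial_i$ with $u_i\in U$. Three bilinear multiplications on $\mathit{Diff}_n$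 are defined on generators by $$u\partial^\alpha \diamond v \partial^\beta=\sum_{\gamma\in \mathbf{Z}^n_0} \binom{\alpha}{\gamma} u\,\partial^\gamma(v)\,\partial^{\alpha+\beta-\gamma},\qquad u\partial^\alpha\circ v\partial^\beta=u\,\partial^\alpha(v)\,\partial^\beta,\qquad u\partial^\alpha \bullet v\partial^\beta= u v\, \partial^{\alpha+\beta},$$ where $\binom{\alpha}{\gamma}=\prod_i\binom{\alpha_i}{\gamma_i}$ (zero unless $\gamma\le\alpha$ componentwise) and $\partial^\alpha(v)$ is the iterated derivative of $v$. The multiplication $\diamond$ (composition) is associative and $\bullet$ is associative and commutative, so the products written without parentheses are well defined. The empty $\diamond$-product is the identity operator $1=\partial^0$. A set partition of $[m]$ is a collection $\{A_1,\dots,A_k\}$ of non-empty pairwise disjoint subsets with union $[m]$. -}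

module Defs where

open import Algebra.Bundles using (CommutativeRing)
open import Algebra.Morphism.Structures using (module RingMorphisms)
open import Data.Bool using (if_then_else_)
open import Data.Bool.Properties using () renaming (_≟_ to _≟ᵇ_)
open import Data.Fin using (Fin; zero; suc)
open import Data.Fin.Subset using (Subset; inside; outside; Nonempty; Empty; _∩_; ⋃; ⊤)
open import Data.Fin.Subset.Properties using (nonempty?; _∈?_)
open import Data.List using (List; []; _∷_; _++_; map; concat; concatMap; foldr; filter; reverse; tabulate; allFin; upTo; cartesianProductWith)
open import Data.List.Relation.Unary.All using (All; all?)
open import Data.List.Relation.Unary.AllPairs using (AllPairs; allPairs?)
open import Data.Nat using (ℕ; zero; suc)
open import Data.Nat.Combinatorics using (_C_)
open import Data.Nat.GeneralisedArithmetic using (fold)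
open import Data.Product using (Σ; _×_; _,_)
open import Data.Vec using (Vec; []; _∷_; replicate; zipWith; _[_]≔_)
open import Data.Vec.Properties using (≡-dec)
open import Level using (Level; _⊔_) renaming (suc to lsuc)
open import Relation.Binary.PropositionalEquality using (_≡_)
open import Relation.Nullary using (Dec; does; ¬?)
open import Relation.Nullary.Decidable using (_×-dec_)
import Algebra.Definitions.RawMonoid as RawMonoidOps
import Data.Nat as ℕ

-- A commutative associative unital K-algebra with n commuting K-linear
-- derivations.  The algebra structure is the ring homomorphism ι : K → U,
-- with scalar multiplication k · u = ι k * u.  No complex numbers are
-- available, so the base is an arbitrary commutative ring K; the classical
-- setting is K = ℂ.
record DifferentialAlgebra {c ℓ : Level} (K : CommutativeRing c ℓ) (n : ℕ) (a b : Level) :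
       Set (c ⊔ ℓ ⊔ lsuc (a ⊔ b)) where
  private module K = CommutativeRing K
  field
    U : CommutativeRing a b
  open CommutativeRing U public
  field
    ι         : K.Carrier → Carrier
    ι-isHom   : RingMorphisms.IsRingHomomorphism K.rawRing rawRing ι
    ∂         : Fin n → Carrier → Carrier
    ∂-cong    : ∀ i {u v} → u ≈ v → ∂ i u ≈ ∂ i v
    ∂-+       : ∀ i u v → ∂ i (u + v) ≈ ∂ i u + ∂ i v
    ∂-scalar  : ∀ i k u → ∂ i (ι k * u) ≈ ι k * ∂ i u
    ∂-leibniz : ∀ i u v → ∂ i (u * v) ≈ ∂ i u * v + u * ∂ i v
    ∂-comm    : ∀ i j u → ∂ i (∂ j u) ≈ ∂ j (∂ i u)

MultiIndex : ℕ → Set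
MultiIndex n = Vec ℕ n

infixl 6 _+ᵐ_ _∸ᵐ_

_+ᵐ_ _∸ᵐ_ : ∀ {n} → MultiIndex n → MultiIndex n → MultiIndex n
_+ᵐ_ = zipWith ℕ._+_
_∸ᵐ_ = zipWith ℕ._∸_

_≟ᵐ_ : ∀ {n} (α β : MultiIndex n) → Dec (α ≡ β)
_≟ᵐ_ = ≡-dec ℕ._≟_

0ᵐ : ∀ {n} → MultiIndex n
0ᵐ = replicate _ 0

unit : ∀ {n} → Fin n → MultiIndex n
unit i = 0ᵐ [ i ]≔ 1

binomial : ∀ {n} → MultiIndex n → MultiIndex n → ℕ
binomial []      []      = 1
binomial (a ∷ α) (c ∷ γ) = (a C c) ℕ.* binomial α γ

-- Each γ with γ ≤ α componentwise, once; the binomial coefficient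
-- vanishes at every other γ.
below : ∀ {n} → MultiIndex n → List (MultiIndex n)
below []      = [] ∷ []
below (a ∷ α) = cartesianProductWith _∷_ (upTo (suc a)) (below α)

-- The composite d₀^α₀ d₁^α₁ ⋯ of iterated operators.
power : ∀ {a} {A : Set a} {n} → (Fin n → A → A) → MultiIndex n → A → A
power d []      u = u
power d (a ∷ α) u = fold (power (λ i → d (suc i)) α u) (d zero) a

-- All sublists, as position sets; applied to a duplicate-free list this
-- gives every finite set of its entries exactly once.
sublists : ∀ {a} {A : Set a} → List A → List (List A)
sublists []       = [] ∷ []
sublists (x ∷ xs) = sublists xs ++ map (x ∷_) (sublists xs)

allSubsets : (m : ℕ) → List (Subset m)
allSubsets zero    = [] ∷ []
allSubsets (suc m) = map (outside ∷_) (allSubsets m) ++ map (inside ∷_) (allSubsets m)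

Disjoint : ∀ {m} → Subset m → Subset m → Set
Disjoint A B = Empty (A ∩ B)

IsSetPartition : ∀ {m} → List (Subset m) → Set
IsSetPartition π = All Nonempty π × AllPairs Disjoint π × ⋃ π ≡ ⊤

isSetPartition? : ∀ {m} (π : List (Subset m)) → Dec (IsSetPartition π)
isSetPartition? π =
  all? nonempty? π
    ×-dec allPairs? (λ A B → ¬? (nonempty? (A ∩ B))) π
    ×-dec ≡-dec _≟ᵇ_ (⋃ π) ⊤

-- A set partition is a set of subsets of [m].  Such sets are represented,
-- once each, by the sublists of allSubsets m.
setPartitions : (m : ℕ) → List (List (Subset m))
setPartitions m = filter isSetPartition? (sublists (allSubsets m))

elements : ∀ {m} → Subset m → List (Fin m)
elements {m} A = filter (_∈? A) (allFin m)

module DifferentialOperators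
  {c ℓ a b : Level} {K : CommutativeRing c ℓ} {n : ℕ}
  (D : DifferentialAlgebra K n a b) where

  open DifferentialAlgebra D
  open RawMonoidOps +-rawMonoid using () renaming (_×_ to _×ᵘ_)

  ∂^ : MultiIndex n → Carrier → Carrier
  ∂^ = power ∂

  -- (u , α) stands for u ∂^α.
  Term : Set a
  Term = Carrier × MultiIndex n

  -- Finite formal sums of terms.  The free U-module on the symbols ∂^α is
  -- this type up to equality _≋_ of all coefficients.
  Diff : Set a
  Diff = List Term

  coeff : Diff → MultiIndex n → Carrier
  coeff []            α = 0#
  coeff ((u , β) ∷ P) α = (if does (β ≟ᵐ α) then u else 0#) + coeff P α

  infix 4 _≋_

  _≋_ : Diff → Diff → Set b
  P ≋ Q = ∀ α → coeff P α ≈ coeff Q α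

  -- Addition of formal sums is concatenation.
  sumᴰ : List Diff → Diff
  sumᴰ = concat

  1ᴰ : Diff
  1ᴰ = (1# , 0ᵐ) ∷ []

  bilinear : (Term → Term → Diff) → Diff → Diff → Diff
  bilinear f P Q = concatMap (λ s → concatMap (f s) Q) P

  infixr 7 _◇_ _∘_ _•_

  _◇_ : Diff → Diff → Diff
  _◇_ = bilinear λ { (u , α) (v , β) →
    map (λ γ → binomial α γ ×ᵘ (u * ∂^ γ v) , (α +ᵐ β) ∸ᵐ γ) (below α) }

  _∘_ : Diff → Diff → Diff
  _∘_ = bilinear λ { (u , α) (v , β) → (u * ∂^ α v , β) ∷ [] }

  _•_ : Diff → Diff → Diff
  _•_ = bilinear λ { (u , α) (v , β) → (u * v , α +ᵐ β) ∷ [] }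

  firstOrder : (Fin n → Carrier) → Diff
  firstOrder u = tabulate λ i → u i , unit i

  IsVect : Diff → Set (a ⊔ b)
  IsVect P = Σ (Fin n → Carrier) λ u → P ≋ firstOrder u

  ◇-product : List Diff → Diff
  ◇-product = foldr _◇_ 1ᴰ

  -- ∂^0 is also the unit of _•_.
  •-product : List Diff → Diff
  •-product = foldr _•_ 1ᴰ

  module _ {m : ℕ} (L : Fin m → Diff) where

    -- For indices i₁ , … , iₛ listed in increasing order: L iₛ ◇ ⋯ ◇ L i₁.
    descending : List (Fin m) → Diff
    descending is = ◇-product (reverse (map L is))

    -- The value at [] is never used: blocks of a partition are non-empty.
    nested : List (Fin m) → Diff
    nested []       = []
    nested (i ∷ is) = descending is ∘ L i

    L-block : Subset m → Diff
    L-block A = nested (elements A)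

    L-partition : List (Subset m) → Diff
    L-partition π = •-product (map L-block π)

{-# OPTIONS --safe #-}
module Submission where

-- Modulo equality of coefficients, Diff is a commutative semiring for _++_ and
-- _•_ (a polynomial ring over U).  A first-order operator X satisfies
--
--   X ◇ P = X • P + X ∘ P,
--   X ∘ (P • Q) = (X ∘ P) • Q + P • (X ∘ Q),
--   (X ◇ P) ∘ Q = X ∘ (P ∘ Q).
--
-- These identities (vect-◇, vect-∘-•, vect-◇-∘) are checked on single terms and
-- extended by linearity; that the three products respect equality of
-- coefficients rests on ∑-≋.
--
-- The first two identities give X ◇ (P • Q) = P • (X ◇ Q) + (X ∘ P) • Q.
-- Iteration over the indices in a set S, smallest first, gives the Leibniz rule
-- compose-◇-leibniz: L_S ◇ (P • Q) is the sum over B ⊆ S of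
-- (L_B ∘ P) • (L_(S ─ B) ◇ Q), where L_S ◇ and L_B ∘ stand for successive
-- left multiplication.  Take for P the operator L₀ of the smallest index and
-- Q = 1.  Since L₀ ◇ 1 = L₀ • 1, the composite of L₀ and the operators in S is
-- the sum over B ⊆ S of the block operator of {0} ∪ B, times the composite of
-- the operators in S ─ B.
--
-- Sums over set partitions, of a product of values attached to the blocks,
-- satisfy the same recursion, by removal of the block that contains the smallest
-- element (partitionSum-inside).  It holds in every commutative semiring and is
-- proved by induction on the list of subsets from which the blocks are chosen.
-- Both sides therefore agree by induction on the number of indices
-- (compose-◇-partitions), for every set of indices and not only for the full
-- one.

open import Defs
open import Algebra.Bundles using (CommutativeRing; CommutativeSemiring)
open import Algebra.Structures.Biased using (isCommutativeSemiringˡ)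
open import Data.Bool using (Bool; if_then_else_; true; false)
open import Data.Bool.Properties using () renaming (_≟_ to _≟ᵇ_)
open import Data.Fin using (Fin; zero; suc)
open import Data.Fin.Subset using (Subset; inside; outside; Nonempty; _∩_; _∪_; _─_; _⊆_; ⋃; ⊥; ⊤)
open import Data.Fin.Subset.Properties
open import Data.List using (List; []; _∷_; _++_; map; foldr; foldl; filter; concatMap; tabulate; allFin; reverse; deduplicate)
open import Data.List.Membership.Propositional using () renaming (_∈_ to _∈ˡ_)
open import Data.List.Membership.Propositional.Properties using (∈-deduplicate⁺; ∈-++⁺ˡ; ∈-++⁺ʳ; ∈-map⁺)
open import Data.List.Properties using (++-assoc; ++-identityʳ; concatMap-++; map-tabulate; map-∘; map-cong; filter-++; filter-≐; filter-all; filter-none; reverse-foldr)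
open import Data.List.Relation.Unary.All as All using (All; []; _∷_; all?)
import Data.List.Relation.Unary.All.Properties as All
open import Data.List.Relation.Unary.AllPairs using (AllPairs; []; _∷_; allPairs?)
open import Data.List.Relation.Unary.Any using (here; there)
open import Data.List.Relation.Unary.Unique.DecPropositional.Properties using (deduplicate-!)
open import Data.List.Relation.Unary.Unique.Propositional using (Unique)
open import Data.Nat using (ℕ; zero; suc; _≤_)
open import Data.Nat.GeneralisedArithmetic using (fold)
import Data.Nat.Properties as ℕ
open import Data.Product using (_×_; _,_; proj₁; proj₂)
open import Data.Sum using (inj₁; inj₂)
open import Data.Vec using ([]; _∷_)
open import Data.Vec.Base using (here; there)
open import Data.Vec.Properties using (≡-dec; zipWith-assoc; zipWith-comm; zipWith-identityˡ)
open import Function using (id) renaming (_∘_ to _∘′_)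
open import Level using (Level; _⊔_)
open import Relation.Binary.PropositionalEquality as ≡ using (_≡_; _≢_; _≗_)
open import Relation.Binary.Structures using (IsEquivalence)
open import Relation.Nullary using (Dec; does; yes; no; ¬?; ¬_; contradiction)
open import Relation.Nullary.Decidable using (_×-dec_)
open import Relation.Unary using (_≐_; Decidable)

private variable
  k m : ℕ

-- Subsets and set partitions

filter-map : ∀ {a b p} {A : Set a} {B : Set b} {P : B → Set p} (P? : Decidable P) (g : A → B) xs →
  filter P? (map g xs) ≡ map g (filter (P? ∘′ g) xs)
filter-map P? g []       = ≡.refl
filter-map P? g (x ∷ xs) with does (P? (g x))
... | true  = ≡.cong (g x ∷_) (filter-map P? g xs)
... | false = filter-map P? g xs

-- The filtered list consists of the indices other than zero.
elements-∷ : ∀ s (S : Subset m) → filter (_∈? (s ∷ S)) (tabulate suc) ≡ map suc (elements S)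
elements-∷ {m} s S = ≡.trans (≡.cong (filter (_∈? (s ∷ S))) (≡.sym (map-tabulate id suc)))
  (≡.trans (filter-map (_∈? (s ∷ S)) suc (allFin m))
    (≡.cong (map suc) (filter-≐ (λ i → suc i ∈? (s ∷ S)) (_∈? S) (drop-there , there) (allFin m))))

elements-outside : (S : Subset m) → elements (outside ∷ S) ≡ map suc (elements S)
elements-outside = elements-∷ outside

elements-inside : (S : Subset m) → elements (inside ∷ S) ≡ zero ∷ map suc (elements S)
elements-inside S = ≡.cong (zero ∷_) (elements-∷ inside S)

elements-⊤ : ∀ m → elements (⊤ {m}) ≡ allFin m
elements-⊤ m = filter-all (_∈? ⊤) (All.universal (λ _ → ∈⊤) (allFin m))

p∪q─p≡q : (p q : Subset m) → Disjoint p q → (p ∪ q) ─ p ≡ q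
p∪q─p≡q []            []            d = ≡.refl
p∪q─p≡q (outside ∷ p) (s ∷ q)       d = ≡.cong (s ∷_) (p∪q─p≡q p q (drop-∷-Empty d))
p∪q─p≡q (inside ∷ p)  (outside ∷ q) d = ≡.cong (outside ∷_) (p∪q─p≡q p q (drop-∷-Empty d))
p∪q─p≡q (inside ∷ p)  (inside ∷ q)  d = contradiction (zero , here) d

q⊆p⇒q∪[p─q]≡p : (p q : Subset m) → q ⊆ p → q ∪ (p ─ q) ≡ p
q⊆p⇒q∪[p─q]≡p []            []            q⊆p = ≡.refl
q⊆p⇒q∪[p─q]≡p (s ∷ p)       (outside ∷ q) q⊆p = ≡.cong (s ∷_) (q⊆p⇒q∪[p─q]≡p p q (drop-∷-⊆ q⊆p))
q⊆p⇒q∪[p─q]≡p (inside ∷ p)  (inside ∷ q)  q⊆p = ≡.cong (inside ∷_) (q⊆p⇒q∪[p─q]≡p p q (drop-∷-⊆ q⊆p))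
q⊆p⇒q∪[p─q]≡p (outside ∷ p) (inside ∷ q)  q⊆p = contradiction (q⊆p here) λ ()

q#p─q : (p q : Subset m) → Disjoint q (p ─ q)
q#p─q (s ∷ p) (inside ∷ q)  (suc i , there i∈) = q#p─q p q (i , i∈)
q#p─q (s ∷ p) (outside ∷ q) (suc i , there i∈) = q#p─q p q (i , i∈)

Disjoint-⋃ : ∀ {A : Subset m} {π} → All (Disjoint A) π → Disjoint A (⋃ π)
Disjoint-⋃ {A = A} [] (i , i∈) = ∉⊥ (proj₂ (x∈p∩q⁻ A ⊥ i∈))
Disjoint-⋃ {A = A} {B ∷ π} (A#B ∷ A#π) (i , i∈)
  with i∈A , i∈B∪π ← x∈p∩q⁻ A (⋃ (B ∷ π)) i∈ with x∈p∪q⁻ B (⋃ π) i∈B∪π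
... | inj₁ i∈B = A#B (i , x∈p∩q⁺ (i∈A , i∈B))
... | inj₂ i∈π = Disjoint-⋃ A#π (i , x∈p∩q⁺ (i∈A , i∈π))

⊆-⋃ : (π : List (Subset m)) → All (_⊆ ⋃ π) π
⊆-⋃ []      = []
⊆-⋃ (A ∷ π) = p⊆p∪q (⋃ π) ∷
  All.map {P = _⊆ ⋃ π} {Q = _⊆ A ∪ ⋃ π} (λ B⊆⋃π i∈B → q⊆p∪q A (⋃ π) (B⊆⋃π i∈B)) (⊆-⋃ π)

Disjoint-⊆ : ∀ {A B C : Subset m} → B ⊆ C → Disjoint A C → Disjoint A B
Disjoint-⊆ {A = A} {B} B⊆C A#C (i , i∈) with i∈A , i∈B ← x∈p∩q⁻ A B i∈ = A#C (i , x∈p∩q⁺ (i∈A , B⊆C i∈B))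

-- IsSetPartition for an arbitrary subset S in place of the whole set: π lists
-- non-empty, pairwise disjoint subsets with union S.
IsPartitionOf : Subset m → List (Subset m) → Set
IsPartitionOf S π = All Nonempty π × AllPairs Disjoint π × ⋃ π ≡ S

isPartitionOf? : (S : Subset m) → Decidable (IsPartitionOf S)
isPartitionOf? S π =
  all? nonempty? π
    ×-dec allPairs? (λ A B → ¬? (nonempty? (A ∩ B))) π
    ×-dec ≡-dec _≟ᵇ_ (⋃ π) S

-- The subsets that can occur as a block of a partition of S.
_isBlockOf_ : Subset m → Subset m → Set
A isBlockOf S = Nonempty A × A ⊆ S

_isBlockOf?_ : (A S : Subset m) → Dec (A isBlockOf S)
A isBlockOf? S = nonempty? A ×-dec A ⊆? S

head-isBlockOf : ∀ {S A : Subset m} {π} → IsPartitionOf S (A ∷ π) → A isBlockOf S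
head-isBlockOf {A = A} {π} (neA ∷ _ , _ , ≡.refl) = neA , p⊆p∪q (⋃ π)

-- A partition of S with first block A amounts to a partition of S ─ A.
tail-isPartitionOf : ∀ {S A : Subset m} → A isBlockOf S →
  (IsPartitionOf S ∘′ (A ∷_)) ≐ IsPartitionOf (S ─ A)
tail-isPartitionOf {S = S} {A} (neA , A⊆S) =
    (λ { {π} (_ ∷ neπ , A#π ∷ #π , ≡.refl) → neπ , #π , ≡.sym (p∪q─p≡q A (⋃ π) (Disjoint-⋃ A#π)) })
  , (λ { {π} (neπ , #π , ⋃π≡) →
         neA ∷ neπ
       , All.map {P = _⊆ ⋃ π}
           (λ {B} B⊆ → Disjoint-⊆ {A = A} {B} B⊆ (≡.subst (Disjoint A) (≡.sym ⋃π≡) (q#p─q S A)))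
           (⊆-⋃ π) ∷ #π
       , ≡.trans (≡.cong (A ∪_) ⋃π≡) (q⊆p⇒q∪[p─q]≡p S A A⊆S) })

-- Finite sums with conditional terms

module Sums {c ℓ} (R : CommutativeSemiring c ℓ) where
  open CommutativeSemiring R hiding (zero)
  open import Algebra.Properties.CommutativeSemigroup +-commutativeSemigroup
    using () renaming (interchange to +-interchange)
  open import Relation.Binary.Reasoning.Setoid setoid

  private variable
    p q : Level
    P Q : Set p
    X Y : Set p

  ∑ : (X → Carrier) → List X → Carrier
  ∑ g xs = foldr _+_ 0# (map g xs)

  ∑-cong : ∀ {g h : X → Carrier} xs → (∀ x → g x ≈ h x) → ∑ g xs ≈ ∑ h xs
  ∑-cong []       g≈h = refl
  ∑-cong (x ∷ xs) g≈h = +-cong (g≈h x) (∑-cong xs g≈h)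

  ∑-zero : (xs : List X) → ∑ (λ _ → 0#) xs ≈ 0#
  ∑-zero []       = refl
  ∑-zero (x ∷ xs) = trans (+-identityˡ _) (∑-zero xs)

  ∑-map : (g : Y → Carrier) (h : X → Y) (xs : List X) → ∑ g (map h xs) ≡ ∑ (g ∘′ h) xs
  ∑-map g h xs = ≡.cong (foldr _+_ 0#) (≡.sym (map-∘ xs))

  ∑-++ : (g : X → Carrier) (xs ys : List X) → ∑ g (xs ++ ys) ≈ ∑ g xs + ∑ g ys
  ∑-++ g []       ys = sym (+-identityˡ _)
  ∑-++ g (x ∷ xs) ys = trans (+-congˡ (∑-++ g xs ys)) (sym (+-assoc _ _ _))

  ∑-+ : (g h : X → Carrier) (xs : List X) → ∑ (λ x → g x + h x) xs ≈ ∑ g xs + ∑ h xs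
  ∑-+ g h []       = sym (+-identityˡ 0#)
  ∑-+ g h (x ∷ xs) = trans (+-congˡ (∑-+ g h xs)) (+-interchange _ _ _ _)

  *-∑ : (u : Carrier) (g : X → Carrier) (xs : List X) → u * ∑ g xs ≈ ∑ (λ x → u * g x) xs
  *-∑ u g []       = zeroʳ u
  *-∑ u g (x ∷ xs) = trans (distribˡ u _ _) (+-congˡ (*-∑ u g xs))

  -- The value x if P holds, and 0# otherwise.  Like the conditional in coeff, it
  -- computes from does P?.
  guard : Dec P → Carrier → Carrier
  guard P? x = if does P? then x else 0#

  guard-⇔ : ∀ {x y} (P? : Dec P) (Q? : Dec Q) → (P → Q) → (Q → P) → (P → x ≈ y) → guard P? x ≈ guard Q? y
  guard-⇔ (yes p) (yes q) to from x≈y = x≈y p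
  guard-⇔ (yes p) (no ¬q) to from x≈y = contradiction (to p) ¬q
  guard-⇔ (no ¬p) (yes q) to from x≈y = contradiction (from q) ¬p
  guard-⇔ (no ¬p) (no ¬q) to from x≈y = refl

  guard-cong : ∀ {x y} (P? : Dec P) → x ≈ y → guard P? x ≈ guard P? y
  guard-cong P? x≈y = guard-⇔ P? P? id id λ _ → x≈y

  guard-yes : ∀ {x} (P? : Dec P) → P → guard P? x ≈ x
  guard-yes (yes _) p = refl
  guard-yes (no ¬p) p = contradiction p ¬p

  guard-no : ∀ {x} (P? : Dec P) → ¬ P → guard P? x ≈ 0#
  guard-no (yes p) ¬p = contradiction p ¬p
  guard-no (no _)  ¬p = refl

  guard-+ : ∀ {x y} (P? : Dec P) → guard P? (x + y) ≈ guard P? x + guard P? y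
  guard-+ (yes _) = refl
  guard-+ (no _)  = sym (+-identityˡ 0#)

  *-guard : ∀ {u x} (P? : Dec P) → u * guard P? x ≈ guard P? (u * x)
  *-guard (yes _) = refl
  *-guard (no _)  = zeroʳ _

  guard-∑ : (P? : Dec P) (g : X → Carrier) (xs : List X) → guard P? (∑ g xs) ≈ ∑ (λ x → guard P? (g x)) xs
  guard-∑ (yes _) g xs = refl
  guard-∑ (no _)  g xs = sym (∑-zero xs)

  guard-× : ∀ {x} (P? : Dec P) (Q? : Dec Q) → guard P? (guard Q? x) ≈ guard (P? ×-dec Q?) x
  guard-× (yes _) Q? = refl
  guard-× (no _)  Q? = refl

-- Sums over set partitions in a commutative semiring

module PartitionSums {c ℓ} (R : CommutativeSemiring c ℓ) where
  open CommutativeSemiring R hiding (zero)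
  open Sums R
  open import Algebra.Properties.CommutativeSemigroup *-commutativeSemigroup using (x∙yz≈y∙xz)
  open import Relation.Binary.Reasoning.Setoid setoid

  -- The product of f over the blocks of π.
  weight : (Subset m → Carrier) → List (Subset m) → Carrier
  weight f π = foldr _*_ 1# (map f π)

  -- The sum of weight f π over the sublists π of As that are partitions of S.
  partitionSum : (Subset m → Carrier) → List (Subset m) → Subset m → Carrier
  partitionSum f As S = ∑ (weight f) (filter (isPartitionOf? S) (sublists As))

  partitionSum-≗ : ∀ {f g : Subset m → Carrier} As S → f ≗ g → partitionSum f As S ≡ partitionSum g As S
  partitionSum-≗ As S f≗g =
    ≡.cong (foldr _+_ 0#)
      (map-cong (λ π → ≡.cong (foldr _*_ 1#) (map-cong f≗g π)) (filter (isPartitionOf? S) (sublists As)))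

  partitionSum-[] : (f : Subset m → Carrier) (S : Subset m) →
    partitionSum f [] S ≈ guard (≡-dec _≟ᵇ_ ⊥ S) 1#
  partitionSum-[] f S with does (≡-dec _≟ᵇ_ ⊥ S)
  ... | true  = +-identityʳ 1#
  ... | false = refl

  -- The partitions of S with blocks in A ∷ As either avoid A or have first
  -- block A.
  partitionSum-∷ : (f : Subset m → Carrier) (A : Subset m) (As : List (Subset m)) (S : Subset m) →
    partitionSum f (A ∷ As) S ≈
      partitionSum f As S + guard (A isBlockOf? S) (f A * partitionSum f As (S ─ A))
  partitionSum-∷ f A As S = begin
    ∑ (weight f) (filter P? (sublists As ++ map (A ∷_) (sublists As)))
      ≡⟨ ≡.cong (∑ (weight f)) (filter-++ P? (sublists As) _) ⟩
    ∑ (weight f) (filter P? (sublists As) ++ filter P? (map (A ∷_) (sublists As)))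
      ≈⟨ ∑-++ (weight f) (filter P? (sublists As)) _ ⟩
    partitionSum f As S + ∑ (weight f) (filter P? (map (A ∷_) (sublists As)))
      ≈⟨ +-congˡ (trans (reflexive (≡.trans (≡.cong (∑ (weight f)) (filter-map P? (A ∷_) (sublists As)))
                                            (∑-map (weight f) (A ∷_) (filter (P? ∘′ (A ∷_)) (sublists As)))))
                        (with-A (A isBlockOf? S))) ⟩
    partitionSum f As S + guard (A isBlockOf? S) (f A * partitionSum f As (S ─ A)) ∎
    where
    P? = isPartitionOf? S
    with-A : (B? : Dec (A isBlockOf S)) →
      ∑ (weight f ∘′ (A ∷_)) (filter (P? ∘′ (A ∷_)) (sublists As)) ≈ guard B? (f A * partitionSum f As (S ─ A))
    with-A (yes block) = begin
      ∑ (weight f ∘′ (A ∷_)) (filter (P? ∘′ (A ∷_)) (sublists As))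
        ≡⟨ ≡.cong (∑ _) (filter-≐ (P? ∘′ (A ∷_)) (isPartitionOf? (S ─ A))
                                  (tail-isPartitionOf block) (sublists As)) ⟩
      ∑ (λ π → f A * weight f π) (filter (isPartitionOf? (S ─ A)) (sublists As))
        ≈⟨ *-∑ (f A) (weight f) (filter (isPartitionOf? (S ─ A)) (sublists As)) ⟨
      f A * partitionSum f As (S ─ A) ∎
    with-A (no ¬block) = reflexive (≡.cong (∑ _)
      (filter-none (P? ∘′ (A ∷_)) (All.universal (λ π part → ¬block (head-isBlockOf part)) (sublists As))))

  outside-block : (A S : Subset m) (s : Bool) {x y : Carrier} → x ≈ y →
    guard ((outside ∷ A) isBlockOf? (s ∷ S)) x ≈ guard (A isBlockOf? S) y
  outside-block A S s x≈y = guard-⇔ ((outside ∷ A) isBlockOf? (s ∷ S)) (A isBlockOf? S)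
    (λ { ((suc i , there i∈A) , A⊆S) → (i , i∈A) , drop-∷-⊆ A⊆S })
    (λ { ((i , i∈A) , A⊆S) → (suc i , there i∈A) , out⊆ A⊆S })
    (λ _ → x≈y)

  -- A set without the element zero has no block containing zero.
  partitionSum-outside : (f : Subset (suc m) → Carrier) (As Bs : List (Subset m)) (S : Subset m) →
    partitionSum f (map (outside ∷_) As ++ map (inside ∷_) Bs) (outside ∷ S) ≈
      partitionSum (f ∘′ (outside ∷_)) As S
  partitionSum-outside f (A ∷ As) Bs S = begin
    partitionSum f ((outside ∷ A) ∷ Cs) (outside ∷ S)
      ≈⟨ partitionSum-∷ f (outside ∷ A) Cs (outside ∷ S) ⟩
    partitionSum f Cs (outside ∷ S)
      + guard ((outside ∷ A) isBlockOf? (outside ∷ S)) (f (outside ∷ A) * partitionSum f Cs (outside ∷ (S ─ A)))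
      ≈⟨ +-cong (partitionSum-outside f As Bs S)
                (outside-block A S outside (*-congˡ (partitionSum-outside f As Bs (S ─ A)))) ⟩
    partitionSum f′ As S + guard (A isBlockOf? S) (f′ A * partitionSum f′ As (S ─ A))
      ≈⟨ partitionSum-∷ f′ A As S ⟨
    partitionSum f′ (A ∷ As) S ∎
    where
    f′ = f ∘′ (outside ∷_)
    Cs = map (outside ∷_) As ++ map (inside ∷_) Bs
  partitionSum-outside f [] (B ∷ Bs) S = begin
    partitionSum f ((inside ∷ B) ∷ Cs) (outside ∷ S)
      ≈⟨ partitionSum-∷ f (inside ∷ B) Cs (outside ∷ S) ⟩
    partitionSum f Cs (outside ∷ S)
      + guard ((inside ∷ B) isBlockOf? (outside ∷ S)) (f (inside ∷ B) * partitionSum f Cs (outside ∷ (S ─ B)))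
      ≈⟨ +-cong (partitionSum-outside f [] Bs S)
                (guard-no {x = f (inside ∷ B) * partitionSum f Cs (outside ∷ (S ─ B))}
                          ((inside ∷ B) isBlockOf? (outside ∷ S))
                          (λ { (_ , B⊆S) → contradiction (B⊆S here) λ () })) ⟩
    partitionSum (f ∘′ (outside ∷_)) [] S + 0#
      ≈⟨ +-identityʳ _ ⟩
    partitionSum (f ∘′ (outside ∷_)) [] S ∎
    where
    Cs = map (inside ∷_) Bs
  partitionSum-outside f [] [] S = begin
    partitionSum f [] (outside ∷ S)           ≈⟨ partitionSum-[] f (outside ∷ S) ⟩
    guard (≡-dec _≟ᵇ_ ⊥ (outside ∷ S)) 1#
      ≈⟨ guard-⇔ (≡-dec _≟ᵇ_ ⊥ (outside ∷ S)) (≡-dec _≟ᵇ_ ⊥ S)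
                 (λ { ≡.refl → ≡.refl }) (λ { ≡.refl → ≡.refl }) (λ _ → refl) ⟩
    guard (≡-dec _≟ᵇ_ ⊥ S) 1#                 ≈⟨ partitionSum-[] (f ∘′ (outside ∷_)) S ⟨
    partitionSum (f ∘′ (outside ∷_)) [] S      ∎

  -- A set with the element zero has exactly one block containing zero, here
  -- inside ∷ B, and the other blocks partition the complement S ─ B.  With
  -- As = Bs = allSubsets m this is the recursion of set partitions on the block
  -- of the smallest element.
  partitionSum-inside : (f : Subset (suc m) → Carrier) (As Bs : List (Subset m)) (S : Subset m) →
    partitionSum f (map (outside ∷_) As ++ map (inside ∷_) Bs) (inside ∷ S) ≈
      ∑ (λ B → guard (B ⊆? S) (f (inside ∷ B) * partitionSum (f ∘′ (outside ∷_)) As (S ─ B))) Bs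
  partitionSum-inside f [] [] S =
    trans (partitionSum-[] f (inside ∷ S)) (guard-no {x = 1#} (≡-dec _≟ᵇ_ ⊥ (inside ∷ S)) (λ ()))
  partitionSum-inside f [] (B ∷ Bs) S = begin
    partitionSum f ((inside ∷ B) ∷ Cs) (inside ∷ S)
      ≈⟨ partitionSum-∷ f (inside ∷ B) Cs (inside ∷ S) ⟩
    partitionSum f Cs (inside ∷ S)
      + guard ((inside ∷ B) isBlockOf? (inside ∷ S)) (f (inside ∷ B) * partitionSum f Cs (outside ∷ (S ─ B)))
      ≈⟨ +-comm _ _ ⟩
    guard ((inside ∷ B) isBlockOf? (inside ∷ S)) (f (inside ∷ B) * partitionSum f Cs (outside ∷ (S ─ B)))
      + partitionSum f Cs (inside ∷ S)
      ≈⟨ +-cong (guard-⇔ ((inside ∷ B) isBlockOf? (inside ∷ S)) (B ⊆? S)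
                   (λ { (_ , B⊆S) → drop-∷-⊆ B⊆S }) (λ B⊆S → (zero , here) , in⊆in B⊆S)
                   (λ _ → *-congˡ (partitionSum-outside f [] Bs (S ─ B))))
                (partitionSum-inside f [] Bs S) ⟩
    ∑ (λ B → guard (B ⊆? S) (f (inside ∷ B) * partitionSum (f ∘′ (outside ∷_)) [] (S ─ B))) (B ∷ Bs) ∎
    where
    Cs = map (inside ∷_) Bs
  partitionSum-inside {m} f (A ∷ As) Bs S = begin
    partitionSum f ((outside ∷ A) ∷ Cs) (inside ∷ S)
      ≈⟨ partitionSum-∷ f (outside ∷ A) Cs (inside ∷ S) ⟩
    partitionSum f Cs (inside ∷ S)
      + guard ((outside ∷ A) isBlockOf? (inside ∷ S)) (f′ A * partitionSum f Cs (inside ∷ (S ─ A)))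
      ≈⟨ +-cong (partitionSum-inside f As Bs S)
                (outside-block A S inside (*-congˡ (partitionSum-inside f As Bs (S ─ A)))) ⟩
    ∑ g Bs + guard (A isBlockOf? S) (f′ A * ∑ h Bs)
      ≈⟨ +-congˡ (guard-cong (A isBlockOf? S) (*-∑ (f′ A) h Bs)) ⟩
    ∑ g Bs + guard (A isBlockOf? S) (∑ (λ B → f′ A * h B) Bs)
      ≈⟨ +-congˡ (guard-∑ (A isBlockOf? S) _ Bs) ⟩
    ∑ g Bs + ∑ (λ B → guard (A isBlockOf? S) (f′ A * h B)) Bs
      ≈⟨ ∑-+ g _ Bs ⟨
    ∑ (λ B → g B + guard (A isBlockOf? S) (f′ A * h B)) Bs
      ≈⟨ ∑-cong Bs termwise ⟩
    ∑ (λ B → guard (B ⊆? S) (f (inside ∷ B) * partitionSum f′ (A ∷ As) (S ─ B))) Bs ∎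
    where
    f′ = f ∘′ (outside ∷_)
    Cs = map (outside ∷_) As ++ map (inside ∷_) Bs
    g h : Subset m → Carrier
    g B = guard (B ⊆? S) (f (inside ∷ B) * partitionSum f′ As (S ─ B))
    h B = guard (B ⊆? (S ─ A)) (f (inside ∷ B) * partitionSum f′ As (S ─ A ─ B))
    -- Both sides say that A and B are disjoint subsets of S.
    exchange : ∀ A B → A ⊆ S → B ⊆ S ─ A → B ⊆ S × A ⊆ S ─ B
    exchange A B A⊆S B⊆S─A = (p─q⊆p S A ∘′ B⊆S─A) , λ {i} i∈A →
      x∈p∧x∉q⇒x∈p─q (A⊆S i∈A) λ i∈B → q#p─q S A (i , x∈p∩q⁺ (i∈A , B⊆S─A i∈B))
    -- To choose A in S and then B in S ─ A amounts to choosing B in S and then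
    -- A in S ─ B.
    termwise : ∀ B → g B + guard (A isBlockOf? S) (f′ A * h B) ≈
      guard (B ⊆? S) (f (inside ∷ B) * partitionSum f′ (A ∷ As) (S ─ B))
    termwise B = begin
      g B + guard (A isBlockOf? S) (f′ A * h B)
        ≈⟨ +-congˡ (trans (guard-cong (A isBlockOf? S) (*-guard (B ⊆? (S ─ A))))
                          (guard-× (A isBlockOf? S) (B ⊆? (S ─ A)))) ⟩
      g B + guard (A isBlockOf? S ×-dec B ⊆? (S ─ A)) (f′ A * (f (inside ∷ B) * partitionSum f′ As (S ─ A ─ B)))
        ≈⟨ +-congˡ (guard-⇔ (A isBlockOf? S ×-dec B ⊆? (S ─ A)) (B ⊆? S ×-dec A isBlockOf? (S ─ B))
             (λ { ((ne , A⊆S) , B⊆) → let B⊆S , A⊆ = exchange A B A⊆S B⊆ in B⊆S , ne , A⊆ })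
             (λ { (B⊆S , ne , A⊆) → let A⊆S , B⊆ = exchange B A B⊆S A⊆ in (ne , A⊆S) , B⊆ })
             (λ _ → trans (x∙yz≈y∙xz _ _ _)
               (reflexive (≡.cong (λ T → f (inside ∷ B) * (f′ A * partitionSum f′ As T)) (p─q─r≡p─r─q S A B))))) ⟩
      g B + guard (B ⊆? S ×-dec A isBlockOf? (S ─ B)) (f (inside ∷ B) * (f′ A * partitionSum f′ As (S ─ B ─ A)))
        ≈⟨ +-congˡ (trans (guard-cong (B ⊆? S) (*-guard (A isBlockOf? (S ─ B))))
                          (guard-× (B ⊆? S) (A isBlockOf? (S ─ B)))) ⟨
      g B + guard (B ⊆? S) (f (inside ∷ B) * guard (A isBlockOf? (S ─ B)) (f′ A * partitionSum f′ As (S ─ B ─ A)))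
        ≈⟨ guard-+ (B ⊆? S) ⟨
      guard (B ⊆? S) (f (inside ∷ B) * partitionSum f′ As (S ─ B)
        + f (inside ∷ B) * guard (A isBlockOf? (S ─ B)) (f′ A * partitionSum f′ As (S ─ B ─ A)))
        ≈⟨ guard-cong (B ⊆? S) (trans (*-congˡ (partitionSum-∷ f′ A As (S ─ B))) (distribˡ _ _ _)) ⟨
      guard (B ⊆? S) (f (inside ∷ B) * partitionSum f′ (A ∷ As) (S ─ B)) ∎

-- Multi-indices

+ᵐ-identityˡ : (α : MultiIndex k) → 0ᵐ +ᵐ α ≡ α
+ᵐ-identityˡ = zipWith-identityˡ ℕ.+-identityˡ

+ᵐ-assoc : (α β γ : MultiIndex k) → (α +ᵐ β) +ᵐ γ ≡ α +ᵐ (β +ᵐ γ)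
+ᵐ-assoc = zipWith-assoc ℕ.+-assoc

+ᵐ-comm : (α β : MultiIndex k) → α +ᵐ β ≡ β +ᵐ α
+ᵐ-comm = zipWith-comm ℕ.+-comm

∸ᵐ-identityʳ : (α : MultiIndex k) → α ∸ᵐ 0ᵐ ≡ α
∸ᵐ-identityʳ []      = ≡.refl
∸ᵐ-identityʳ (a ∷ α) = ≡.cong (a ∷_) (∸ᵐ-identityʳ α)

[α+β]∸α≡β : (α β : MultiIndex k) → (α +ᵐ β) ∸ᵐ α ≡ β
[α+β]∸α≡β []      []      = ≡.refl
[α+β]∸α≡β (a ∷ α) (b ∷ β) = ≡.cong₂ _∷_ (ℕ.m+n∸m≡n a b) ([α+β]∸α≡β α β)

binomial-0-0 : ∀ k → binomial (0ᵐ {k}) 0ᵐ ≡ 1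
binomial-0-0 zero    = ≡.refl
binomial-0-0 (suc k) = ≡.trans (ℕ.+-identityʳ _) (binomial-0-0 k)

binomial-unit-0 : (i : Fin k) → binomial (unit i) 0ᵐ ≡ 1
binomial-unit-0 {suc k} zero = ≡.trans (ℕ.+-identityʳ _) (binomial-0-0 k)
binomial-unit-0 (suc i) = ≡.trans (ℕ.+-identityʳ _) (binomial-unit-0 i)

binomial-unit-unit : (i : Fin k) → binomial (unit i) (unit i) ≡ 1
binomial-unit-unit {suc k} zero = ≡.trans (ℕ.+-identityʳ _) (binomial-0-0 k)
binomial-unit-unit (suc i) = ≡.trans (ℕ.+-identityʳ _) (binomial-unit-unit i)

below-0 : ∀ k → below (0ᵐ {k}) ≡ 0ᵐ ∷ []
below-0 zero    = ≡.refl
below-0 (suc k) rewrite below-0 k = ≡.refl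

-- Hence a ◇-product with u ∂ᵢ on the left has exactly two terms.
below-unit : (i : Fin k) → below (unit i) ≡ 0ᵐ ∷ unit i ∷ []
below-unit {suc k} zero    rewrite below-0 k    = ≡.refl
below-unit {suc k} (suc i) rewrite below-unit i = ≡.refl

power-0 : ∀ {a} {A : Set a} (d : Fin k → A → A) (u : A) → power d 0ᵐ u ≡ u
power-0 {zero}  d u = ≡.refl
power-0 {suc k} d u = power-0 (λ i → d (suc i)) u

power-unit : ∀ {a} {A : Set a} (d : Fin k → A → A) (i : Fin k) (u : A) → power d (unit i) u ≡ d i u
power-unit d zero    u = ≡.cong (d zero) (power-0 (λ i → d (suc i)) u)
power-unit d (suc i) u = power-unit (λ i → d (suc i)) i u

-- The algebra of differential operators

module DiffAlgebra {c ℓ a b} {K : CommutativeRing c ℓ} {n : ℕ} (D : DifferentialAlgebra K n a b) where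
  open DifferentialAlgebra D hiding (zero)
  open DifferentialOperators D
  open Sums commutativeSemiring
  open import Algebra.Properties.CommutativeSemigroup +-commutativeSemigroup
    using () renaming (interchange to +-interchange)
  open import Algebra.Properties.CommutativeMonoid.Mult +-commutativeMonoid
    using (×-congʳ; ×-congˡ; ×-homo-1; ×-distrib-+)
    renaming (_×_ to _×ᵘ_)
  open import Algebra.Properties.Group +-group using (identityˡ-unique)
  open import Relation.Binary.Reasoning.Setoid setoid

  -- Endomorphisms of the additive group of U.
  record Additive (h : Carrier → Carrier) : Set (a ⊔ b) where
    field
      cong : ∀ {u v} → u ≈ v → h u ≈ h v
      homo : ∀ u v → h (u + v) ≈ h u + h v

    zero-homo : h 0# ≈ 0#
    zero-homo = identityˡ-unique (h 0#) (h 0#) (trans (sym (homo 0# 0#)) (cong (+-identityˡ 0#)))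

  open Additive

  private variable
    g h : Carrier → Carrier

  id-additive : Additive id
  id-additive = record { cong = id ; homo = λ _ _ → refl }

  0-additive : Additive (λ _ → 0#)
  0-additive = record { cong = λ _ → refl ; homo = λ _ _ → sym (+-identityˡ 0#) }

  ∘-additive : Additive g → Additive h → Additive (λ u → g (h u))
  ∘-additive G H = record
    { cong = λ u≈v → cong G (cong H u≈v)
    ; homo = λ u v → trans (cong G (homo H u v)) (homo G _ _)
    }

  +-additive : Additive g → Additive h → Additive (λ u → g u + h u)
  +-additive G H = record
    { cong = λ u≈v → +-cong (cong G u≈v) (cong H u≈v)
    ; homo = λ u v → trans (+-cong (homo G u v) (homo H u v)) (+-interchange _ _ _ _)
    }

  *-additiveˡ : ∀ v → Additive (_* v)
  *-additiveˡ v = record { cong = *-congʳ ; homo = λ _ _ → distribʳ v _ _ }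

  *-additiveʳ : ∀ u → Additive (u *_)
  *-additiveʳ u = record { cong = *-congˡ ; homo = distribˡ u }

  ×-additive : ∀ k → Additive (k ×ᵘ_)
  ×-additive k = record { cong = ×-congʳ k ; homo = λ u v → ×-distrib-+ u v k }

  ∂-additive : ∀ i → Additive (∂ i)
  ∂-additive i = record { cong = ∂-cong i ; homo = ∂-+ i }

  fold-additive : Additive g → Additive h → ∀ k → Additive (λ u → fold (g u) h k)
  fold-additive G H zero    = G
  fold-additive G H (suc k) = ∘-additive H (fold-additive G H k)

  power-additive : (d : Fin k → Carrier → Carrier) → (∀ i → Additive (d i)) → ∀ α → Additive (power d α)
  power-additive d d+ []      = id-additive
  power-additive d d+ (a ∷ α) = fold-additive (power-additive (λ i → d (suc i)) (λ i → d+ (suc i)) α) (d+ zero) a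

  ∂^-additive : ∀ α → Additive (∂^ α)
  ∂^-additive = power-additive ∂ ∂-additive

  guard-additive : ∀ {p} {P : Set p} (P? : Dec P) → Additive (guard P?)
  guard-additive P? = record { cong = guard-cong P? ; homo = λ _ _ → guard-+ P? }

  fold-cong : Additive h → ∀ {u v} k → u ≈ v → fold u h k ≈ fold v h k
  fold-cong H zero    u≈v = u≈v
  fold-cong H (suc k) u≈v = cong H (fold-cong H k u≈v)

  fold-comm : Additive h → (∀ u → h (g u) ≈ g (h u)) → ∀ u k → fold (g u) h k ≈ g (fold u h k)
  fold-comm H hg≈gh u zero    = refl
  fold-comm H hg≈gh u (suc k) = trans (cong H (fold-comm H hg≈gh u k)) (hg≈gh _)

  -- For commuting d the factor d i can be moved to the front of the composite.
  power-unit-+ : (d : Fin k → Carrier → Carrier) → (∀ i → Additive (d i)) →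
    (∀ i j u → d i (d j u) ≈ d j (d i u)) →
    ∀ i β u → power d (unit i +ᵐ β) u ≈ d i (power d β u)
  power-unit-+ d d+ comm zero (b ∷ β) u =
    reflexive (≡.cong (λ γ → fold (power (λ i → d (suc i)) γ u) (d zero) (suc b)) (+ᵐ-identityˡ β))
  power-unit-+ d d+ comm (suc i) (b ∷ β) u = trans
    (fold-cong (d+ zero) b
      (power-unit-+ (λ i → d (suc i)) (λ i → d+ (suc i)) (λ i j → comm (suc i) (suc j)) i β u))
    (fold-comm (d+ zero) (comm zero (suc i)) _ b)

  ∂^-unit-+ : ∀ i β u → ∂^ (unit i +ᵐ β) u ≈ ∂ i (∂^ β u)
  ∂^-unit-+ = power-unit-+ ∂ ∂-additive ∂-comm

  ∂-1 : ∀ i → ∂ i 1# ≈ 0#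
  ∂-1 i = identityˡ-unique (∂ i 1#) (∂ i 1#) (begin
    ∂ i 1# + ∂ i 1#               ≈⟨ +-cong (*-identityʳ _) (*-identityˡ _) ⟨
    ∂ i 1# * 1# + 1# * ∂ i 1#     ≈⟨ ∂-leibniz i 1# 1# ⟨
    ∂ i (1# * 1#)                 ≈⟨ ∂-cong i (*-identityˡ 1#) ⟩
    ∂ i 1#                        ∎)

  ∂^-unit : ∀ i u → ∂^ (unit i) u ≡ ∂ i u
  ∂^-unit = power-unit ∂

  ∂^-0 : ∀ u → ∂^ 0ᵐ u ≡ u
  ∂^-0 = power-0 ∂

  -- Coefficients

  coeff-++ : ∀ P Q δ → coeff (P ++ Q) δ ≈ coeff P δ + coeff Q δ
  coeff-++ []            Q δ = sym (+-identityˡ _)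
  coeff-++ ((u , α) ∷ P) Q δ = trans (+-congˡ (coeff-++ P Q δ)) (sym (+-assoc _ _ _))

  coeff-concatMap : {X : Set a} (φ : X → Diff) (xs : List X) → ∀ δ →
    coeff (concatMap φ xs) δ ≈ ∑ (λ x → coeff (φ x) δ) xs
  coeff-concatMap φ []       δ = refl
  coeff-concatMap φ (x ∷ xs) δ = trans (coeff-++ (φ x) (concatMap φ xs) δ) (+-congˡ (coeff-concatMap φ xs δ))

  -- Given additive maps h α, the sum of h α u over the terms u ∂^α of P depends
  -- only on the coefficients of P.  This makes bilinear extensions respect _≋_.
  module _ (h : MultiIndex n → Carrier → Carrier) (h+ : ∀ α → Additive (h α)) where

    ∑-indicator-∉ : ∀ {β αs} u → All (λ α → β ≢ α) αs → ∑ (λ α → h α (guard (β ≟ᵐ α) u)) αs ≈ 0#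
    ∑-indicator-∉         u []           = refl
    ∑-indicator-∉ {β} {α ∷ _} u (β≢α ∷ β∉) = trans
      (+-cong (trans (cong (h+ α) (guard-no (β ≟ᵐ α) β≢α)) (zero-homo (h+ α))) (∑-indicator-∉ u β∉))
      (+-identityˡ 0#)

    ∑-indicator : ∀ {β αs} u → Unique αs → β ∈ˡ αs → ∑ (λ α → h α (guard (β ≟ᵐ α) u)) αs ≈ h β u
    ∑-indicator {β} u (β∉ ∷ _) (here ≡.refl) = trans
      (+-cong (cong (h+ β) (guard-yes (β ≟ᵐ β) ≡.refl)) (∑-indicator-∉ u β∉))
      (+-identityʳ _)
    ∑-indicator {β} {α ∷ _} u (α∉ ∷ uniq) (there β∈) = trans
      (+-cong (trans (cong (h+ α) (guard-no (β ≟ᵐ α) (λ β≡α → All.lookup α∉ β∈ (≡.sym β≡α)))) (zero-homo (h+ α)))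
              (∑-indicator u uniq β∈))
      (+-identityˡ _)

    -- Terms with the same index are collected; αs lists at least the indices
    -- that occur in P.
    ∑-collect : ∀ {αs} P → Unique αs → All (λ t → proj₂ t ∈ˡ αs) P →
      ∑ (λ (u , α) → h α u) P ≈ ∑ (λ α → h α (coeff P α)) αs
    ∑-collect {αs} [] uniq [] = sym (trans (∑-cong αs (λ α → zero-homo (h+ α))) (∑-zero αs))
    ∑-collect {αs} ((u , β) ∷ P) uniq (β∈ ∷ P⊆) = begin
      h β u + ∑ (λ (u , α) → h α u) P
        ≈⟨ +-cong (sym (∑-indicator u uniq β∈)) (∑-collect P uniq P⊆) ⟩
      ∑ (λ α → h α (guard (β ≟ᵐ α) u)) αs + ∑ (λ α → h α (coeff P α)) αs
        ≈⟨ ∑-+ _ _ αs ⟨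
      ∑ (λ α → h α (guard (β ≟ᵐ α) u) + h α (coeff P α)) αs
        ≈⟨ ∑-cong αs (λ α → homo (h+ α) _ _) ⟨
      ∑ (λ α → h α (coeff ((u , β) ∷ P) α)) αs ∎

    ∑-≋ : ∀ P Q → P ≋ Q → ∑ (λ (u , α) → h α u) P ≈ ∑ (λ (u , α) → h α u) Q
    ∑-≋ P Q P≋Q = begin
      ∑ (λ (u , α) → h α u) P            ≈⟨ ∑-collect P uniq (All.tabulate P⊆) ⟩
      ∑ (λ α → h α (coeff P α)) αs       ≈⟨ ∑-cong αs (λ α → cong (h+ α) (P≋Q α)) ⟩
      ∑ (λ α → h α (coeff Q α)) αs       ≈⟨ ∑-collect Q uniq (All.tabulate Q⊆) ⟨
      ∑ (λ (u , α) → h α u) Q            ∎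
      where
      αs = deduplicate _≟ᵐ_ (map proj₂ P ++ map proj₂ Q)
      uniq : Unique αs
      uniq = deduplicate-! _≟ᵐ_ (map proj₂ P ++ map proj₂ Q)
      P⊆ : ∀ {t} → t ∈ˡ P → proj₂ t ∈ˡ αs
      P⊆ t∈P = ∈-deduplicate⁺ _≟ᵐ_ (∈-++⁺ˡ (∈-map⁺ proj₂ t∈P))
      Q⊆ : ∀ {t} → t ∈ˡ Q → proj₂ t ∈ˡ αs
      Q⊆ t∈Q = ∈-deduplicate⁺ _≟ᵐ_ (∈-++⁺ʳ (map proj₂ P) (∈-map⁺ proj₂ t∈Q))

  -- Equality of coefficients as a record: unlike the function type _≋_, it lets
  -- both operators be inferred from a proof.
  record _≃_ (P Q : Diff) : Set b where
    constructor coeffwise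
    field coeffs : P ≋ Q
  open _≃_
  infix 4 _≃_

  ≃-refl : ∀ {P} → P ≃ P
  ≃-refl = coeffwise λ _ → refl

  ≃-reflexive : ∀ {P Q} → P ≡ Q → P ≃ Q
  ≃-reflexive ≡.refl = ≃-refl

  ≃-sym : ∀ {P Q} → P ≃ Q → Q ≃ P
  ≃-sym P≃Q = coeffwise λ δ → sym (coeffs P≃Q δ)

  ≃-trans : ∀ {P Q R} → P ≃ Q → Q ≃ R → P ≃ R
  ≃-trans P≃Q Q≃R = coeffwise λ δ → trans (coeffs P≃Q δ) (coeffs Q≃R δ)

  ++-cong : ∀ {P P′ Q Q′} → P ≃ P′ → Q ≃ Q′ → P ++ Q ≃ P′ ++ Q′
  ++-cong {P} {P′} {Q} {Q′} P≃ Q≃ = coeffwise λ δ →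
    trans (coeff-++ P Q δ) (trans (+-cong (coeffs P≃ δ) (coeffs Q≃ δ)) (sym (coeff-++ P′ Q′ δ)))

  ++-comm : ∀ P Q → P ++ Q ≃ Q ++ P
  ++-comm P Q = coeffwise λ δ → trans (coeff-++ P Q δ) (trans (+-comm _ _) (sym (coeff-++ Q P δ)))

  term-cong : ∀ {u v α β} → u ≈ v → α ≡ β → (u , α) ∷ [] ≃ (v , β) ∷ []
  term-cong {α = α} u≈v ≡.refl = coeffwise λ δ → +-congʳ (guard-cong (α ≟ᵐ δ) u≈v)

  term-+ : ∀ u v α → (u + v , α) ∷ [] ≃ (u , α) ∷ (v , α) ∷ []
  term-+ u v α = coeffwise λ δ → trans (+-congʳ (guard-+ (α ≟ᵐ δ))) (+-assoc _ _ _)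

  term-0 : ∀ {u} α → u ≈ 0# → (u , α) ∷ [] ≃ []
  term-0 α u≈0 = coeffwise λ δ →
    trans (+-identityʳ _) (trans (guard-cong (α ≟ᵐ δ) u≈0) (zero-homo (guard-additive (α ≟ᵐ δ))))

  -- Linear maps, and bilinear products

  -- Endomorphisms of Diff as an additive monoid up to _≃_.
  record Linear (F : Diff → Diff) : Set (a ⊔ b) where
    field
      ≃-cong  : ∀ {P Q} → P ≃ Q → F P ≃ F Q
      ++-homo : ∀ P Q → F (P ++ Q) ≃ F P ++ F Q
      []-homo : F [] ≃ []
  open Linear

  id-linear : Linear id
  id-linear = record { ≃-cong = id ; ++-homo = λ _ _ → ≃-refl ; []-homo = ≃-refl }

  ∘-linear : ∀ {F G} → Linear F → Linear G → Linear (λ P → F (G P))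
  ∘-linear lF lG = record
    { ≃-cong  = λ P≃Q → ≃-cong lF (≃-cong lG P≃Q)
    ; ++-homo = λ P Q → ≃-trans (≃-cong lF (++-homo lG P Q)) (++-homo lF _ _)
    ; []-homo = ≃-trans (≃-cong lF ([]-homo lG)) ([]-homo lF)
    }

  ++-interchange : ∀ P Q R S → (P ++ Q) ++ (R ++ S) ≃ (P ++ R) ++ (Q ++ S)
  ++-interchange P Q R S = coeffwise λ δ →
    trans (split P Q R S δ) (trans (+-interchange _ _ _ _) (sym (split P R Q S δ)))
    where
    split : ∀ P Q R S δ → coeff ((P ++ Q) ++ (R ++ S)) δ ≈ (coeff P δ + coeff Q δ) + (coeff R δ + coeff S δ)
    split P Q R S δ = trans (coeff-++ (P ++ Q) (R ++ S) δ) (+-cong (coeff-++ P Q δ) (coeff-++ R S δ))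

  ++-linear : ∀ {F G} → Linear F → Linear G → Linear (λ P → F P ++ G P)
  ++-linear {F} {G} lF lG = record
    { ≃-cong  = λ P≃Q → ++-cong (≃-cong lF P≃Q) (≃-cong lG P≃Q)
    ; ++-homo = λ P Q → ≃-trans (++-cong (++-homo lF P Q) (++-homo lG P Q))
                                (++-interchange (F P) (F Q) (G P) (G Q))
    ; []-homo = ++-cong ([]-homo lF) ([]-homo lG)
    }

  []-linear : Linear (λ _ → [])
  []-linear = record { ≃-cong = λ _ → ≃-refl ; ++-homo = λ _ _ → ≃-refl ; []-homo = ≃-refl }

  -- Linear maps that agree on the terms of P agree at P.
  linear-ext : ∀ {F G} → Linear F → Linear G → ∀ {P} → All (λ t → F (t ∷ []) ≃ G (t ∷ [])) P → F P ≃ G P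
  linear-ext lF lG []                    = ≃-trans ([]-homo lF) (≃-sym ([]-homo lG))
  linear-ext lF lG {t ∷ P} (Ft≃Gt ∷ F≃G) = ≃-trans (++-homo lF (t ∷ []) P)
    (≃-trans (++-cong Ft≃Gt (linear-ext lF lG F≃G)) (≃-sym (++-homo lG (t ∷ []) P)))

  -- Products that are additive, and respect _≃_, in each argument.
  record Bilinear (_⊗_ : Diff → Diff → Diff) : Set (a ⊔ b) where
    field
      linearˡ : ∀ Q → Linear (_⊗ Q)
      linearʳ : ∀ P → Linear (P ⊗_)
  open Bilinear

  -- A product of terms is additive in the left, respectively right, coefficient.
  AdditiveInˡ AdditiveInʳ : (Term → Term → Diff) → Set (a ⊔ b)
  AdditiveInˡ f = ∀ α t δ → Additive (λ u → coeff (f (u , α) t) δ)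
  AdditiveInʳ f = ∀ s β δ → Additive (λ v → coeff (f s (v , β)) δ)

  ∑-additive : {X : Set a} (h : X → Carrier → Carrier) → (∀ x → Additive (h x)) →
    ∀ xs → Additive (λ u → ∑ (λ x → h x u) xs)
  ∑-additive h h+ []       = 0-additive
  ∑-additive h h+ (x ∷ xs) = +-additive (h+ x) (∑-additive h h+ xs)

  concatMap-linear : (φ : Term → Diff) → (∀ α δ → Additive (λ u → coeff (φ (u , α)) δ)) → Linear (concatMap φ)
  concatMap-linear φ φ+ = record
    { ≃-cong  = λ {P} {Q} P≃Q → coeffwise λ δ →
        trans (coeff-concatMap φ P δ)
        (trans (∑-≋ (λ α u → coeff (φ (u , α)) δ) (λ α → φ+ α δ) P Q (coeffs P≃Q))
        (sym (coeff-concatMap φ Q δ)))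
    ; ++-homo = λ P Q → ≃-reflexive (concatMap-++ φ P Q)
    ; []-homo = ≃-refl
    }

  additive-resp : (∀ u → g u ≈ h u) → Additive h → Additive g
  additive-resp g≈h h+ = record
    { cong = λ u≈v → trans (g≈h _) (trans (cong h+ u≈v) (sym (g≈h _)))
    ; homo = λ u v → trans (g≈h _) (trans (homo h+ u v) (sym (+-cong (g≈h u) (g≈h v))))
    }

  bilinear-isBilinear : ∀ f → AdditiveInˡ f → AdditiveInʳ f → Bilinear (bilinear f)
  bilinear-isBilinear f f+ˡ f+ʳ = record
    { linearˡ = λ Q → concatMap-linear (λ s → concatMap (f s) Q) λ α δ →
        additive-resp (λ u → coeff-concatMap (f (u , α)) Q δ)
                      (∑-additive (λ t u → coeff (f (u , α) t) δ) (λ t → f+ˡ α t δ) Q)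
    ; linearʳ = linʳ
    }
    where
    linʳ : ∀ P → Linear (bilinear f P)
    linʳ []      = []-linear
    linʳ (s ∷ P) = ++-linear (concatMap-linear (f s) (f+ʳ s)) (linʳ P)

  terms-additive : ∀ {x} {X : Set x} (k : X → Carrier → Carrier) (ι : X → MultiIndex n) →
    (∀ x → Additive (k x)) → ∀ xs δ → Additive (λ u → coeff (map (λ x → k x u , ι x) xs) δ)
  terms-additive k ι k+ []       δ = 0-additive
  terms-additive k ι k+ (x ∷ xs) δ =
    +-additive (∘-additive (guard-additive (ι x ≟ᵐ δ)) (k+ x)) (terms-additive k ι k+ xs δ)

  term-additive : ∀ γ → Additive h → ∀ δ → Additive (λ u → coeff ((h u , γ) ∷ []) δ)
  term-additive γ h+ δ = +-additive (∘-additive (guard-additive (γ ≟ᵐ δ)) h+) 0-additive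

  •-bilinear : Bilinear _•_
  •-bilinear = bilinear-isBilinear _
    (λ α (v , β) → term-additive (α +ᵐ β) (*-additiveˡ v))
    (λ (u , α) β → term-additive (α +ᵐ β) (*-additiveʳ u))

  ∘-bilinear : Bilinear _∘_
  ∘-bilinear = bilinear-isBilinear _
    (λ α (v , β) → term-additive β (*-additiveˡ (∂^ α v)))
    (λ (u , α) β → term-additive β (∘-additive (*-additiveʳ u) (∂^-additive α)))

  ◇-bilinear : Bilinear _◇_
  ◇-bilinear = bilinear-isBilinear _
    (λ α (v , β) → terms-additive
      (λ γ u → binomial α γ ×ᵘ (u * ∂^ γ v)) (λ γ → (α +ᵐ β) ∸ᵐ γ)
      (λ γ → ∘-additive (×-additive (binomial α γ)) (*-additiveˡ (∂^ γ v))) (below α))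
    (λ (u , α) β → terms-additive
      (λ γ v → binomial α γ ×ᵘ (u * ∂^ γ v)) (λ γ → (α +ᵐ β) ∸ᵐ γ)
      (λ γ → ∘-additive (×-additive (binomial α γ)) (∘-additive (*-additiveʳ u) (∂^-additive γ))) (below α))

  open Bilinear •-bilinear public using () renaming (linearˡ to •-linearˡ; linearʳ to •-linearʳ)
  open Bilinear ∘-bilinear public using () renaming (linearˡ to ∘-linearˡ; linearʳ to ∘-linearʳ)
  open Bilinear ◇-bilinear public using () renaming (linearˡ to ◇-linearˡ; linearʳ to ◇-linearʳ)

  -- A term as an operator.
  ⟦_⟧ : Term → Diff
  ⟦ t ⟧ = t ∷ []

  terms-ext : ∀ {F G} → Linear F → Linear G → (∀ t → F ⟦ t ⟧ ≃ G ⟦ t ⟧) → ∀ P → F P ≃ G P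
  terms-ext lF lG F≃G P = linear-ext lF lG (All.universal F≃G P)

  •-comm : ∀ P Q → P • Q ≃ Q • P
  •-comm P Q = terms-ext (•-linearˡ Q) (•-linearʳ Q)
    (λ (u , α) → terms-ext (•-linearʳ ⟦ u , α ⟧) (•-linearˡ ⟦ u , α ⟧)
      (λ (v , β) → term-cong (*-comm u v) (+ᵐ-comm α β)) Q) P

  •-assoc : ∀ P Q R → (P • Q) • R ≃ P • (Q • R)
  •-assoc P Q R = terms-ext (∘-linear (•-linearˡ R) (•-linearˡ Q)) (•-linearˡ (Q • R))
    (λ s@(u , α) → terms-ext (∘-linear (•-linearˡ R) (•-linearʳ ⟦ s ⟧)) (∘-linear (•-linearʳ ⟦ s ⟧) (•-linearˡ R))
      (λ t@(v , β) → terms-ext (•-linearʳ (⟦ s ⟧ • ⟦ t ⟧)) (∘-linear (•-linearʳ ⟦ s ⟧) (•-linearʳ ⟦ t ⟧))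
        (λ (w , γ) → term-cong (*-assoc u v w) (+ᵐ-assoc α β γ)) R) Q) P

  •-identityˡ : ∀ P → 1ᴰ • P ≃ P
  •-identityˡ = terms-ext (•-linearʳ 1ᴰ) id-linear λ (u , α) → term-cong (*-identityˡ u) (+ᵐ-identityˡ α)

  -- Up to _≃_ this is the polynomial ring in n variables over U, since _•_
  -- multiplies symbols.
  Diff-commutativeSemiring : CommutativeSemiring a b
  Diff-commutativeSemiring = record
    { Carrier = Diff
    ; _≈_     = _≃_
    ; _+_     = _++_
    ; _*_     = _•_
    ; 0#      = []
    ; 1#      = 1ᴰ
    ; isCommutativeSemiring = isCommutativeSemiringˡ record
      { +-isCommutativeMonoid = record
        { isMonoid = record
          { isSemigroup = record
            { isMagma = record { isEquivalence = ≃-isEquivalence ; ∙-cong = ++-cong }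
            ; assoc = λ P Q R → ≃-reflexive (++-assoc P Q R)
            }
          ; identity = (λ _ → ≃-refl) , (λ P → ≃-reflexive (++-identityʳ P))
          }
        ; comm = ++-comm
        }
      ; *-isCommutativeMonoid = record
        { isMonoid = record
          { isSemigroup = record
            { isMagma = record
              { isEquivalence = ≃-isEquivalence
              ; ∙-cong = λ {P} {P′} {Q} {Q′} P≃P′ Q≃Q′ →
                  ≃-trans (≃-cong (•-linearˡ Q) P≃P′) (≃-cong (•-linearʳ P′) Q≃Q′)
              }
            ; assoc = •-assoc
            }
          ; identity = •-identityˡ , (λ P → ≃-trans (•-comm P 1ᴰ) (•-identityˡ P))
          }
        ; comm = •-comm
        }
      ; distribʳ = λ R P Q → ++-homo (•-linearˡ R) P Q
      ; zeroˡ    = λ _ → ≃-refl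
      }
    }
    where
    ≃-isEquivalence : IsEquivalence _≃_
    ≃-isEquivalence = record { refl = ≃-refl ; sym = ≃-sym ; trans = ≃-trans }

  -- First-order operators

  -- Linear maps that agree on all u ∂ᵢ agree on Vect.
  vect-ext : ∀ {F G} → Linear F → Linear G → (∀ u i → F ⟦ u , unit i ⟧ ≃ G ⟦ u , unit i ⟧) →
    ∀ X → IsVect X → F X ≃ G X
  vect-ext lF lG F≃G X (u , X≋) = ≃-trans (≃-cong lF (coeffwise X≋))
    (≃-trans (linear-ext lF lG (All.tabulate⁺ (λ i → F≃G (u i) i))) (≃-sym (≃-cong lG (coeffwise X≋))))

  vect-◇ : ∀ X → IsVect X → ∀ P → X ◇ P ≃ X • P ++ X ∘ P
  vect-◇ X vX P = vect-ext (◇-linearˡ P) (++-linear (•-linearˡ P) (∘-linearˡ P))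
    (λ u i → terms-ext (◇-linearʳ ⟦ u , unit i ⟧)
                       (++-linear (•-linearʳ ⟦ u , unit i ⟧) (∘-linearʳ ⟦ u , unit i ⟧))
      (on-terms u i) P) X vX
    where
    on-terms : ∀ u i t → ⟦ u , unit i ⟧ ◇ ⟦ t ⟧ ≃ ⟦ u , unit i ⟧ • ⟦ t ⟧ ++ ⟦ u , unit i ⟧ ∘ ⟦ t ⟧
    -- The index γ = 0 of the ◇-product gives the •-term, and γ = unit i the
    -- ∘-term.
    on-terms u i (v , β) rewrite below-unit i = ++-cong
      (term-cong (trans (×-congˡ (binomial-unit-0 i)) (trans (×-homo-1 _) (*-congˡ (reflexive (∂^-0 v)))))
                 (∸ᵐ-identityʳ _))
      (term-cong (trans (×-congˡ (binomial-unit-unit i)) (×-homo-1 _)) ([α+β]∸α≡β (unit i) β))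

  -- The action X ∘_ of a first-order operator is a derivation of _•_.
  vect-∘-• : ∀ X → IsVect X → ∀ P Q → X ∘ (P • Q) ≃ (X ∘ P) • Q ++ P • (X ∘ Q)
  vect-∘-• X vX P Q = vect-ext
    (∘-linearˡ (P • Q))
    (++-linear (∘-linear (•-linearˡ Q) (∘-linearˡ P)) (∘-linear (•-linearʳ P) (∘-linearˡ Q)))
    (λ u i → let X = ⟦ u , unit i ⟧ in terms-ext
      (∘-linear (∘-linearʳ X) (•-linearˡ Q))
      (++-linear (∘-linear (•-linearˡ Q) (∘-linearʳ X)) (•-linearˡ (X ∘ Q)))
      (λ s → terms-ext
        (∘-linear (∘-linearʳ X) (•-linearʳ ⟦ s ⟧))
        (++-linear (•-linearʳ (X ∘ ⟦ s ⟧)) (∘-linear (•-linearʳ ⟦ s ⟧) (∘-linearʳ X)))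
        (on-terms u i s) Q) P) X vX
    where
    on-terms : ∀ u i s t → let X = ⟦ u , unit i ⟧ in
      X ∘ (⟦ s ⟧ • ⟦ t ⟧) ≃ (X ∘ ⟦ s ⟧) • ⟦ t ⟧ ++ ⟦ s ⟧ • (X ∘ ⟦ t ⟧)
    on-terms u i (v , α) (w , β)
      rewrite ∂^-unit i (v * w) | ∂^-unit i v | ∂^-unit i w = ≃-trans
        (term-cong (begin
          u * ∂ i (v * w)                       ≈⟨ *-congˡ (∂-leibniz i v w) ⟩
          u * (∂ i v * w + v * ∂ i w)           ≈⟨ distribˡ u _ _ ⟩
          u * (∂ i v * w) + u * (v * ∂ i w)     ≈⟨ +-cong (sym (*-assoc u _ w)) (x∙yz≈y∙xz u v _) ⟩
          (u * ∂ i v) * w + v * (u * ∂ i w)     ∎) ≡.refl)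
        (term-+ _ _ (α +ᵐ β))
      where open import Algebra.Properties.CommutativeSemigroup *-commutativeSemigroup using (x∙yz≈y∙xz)

  -- The product _∘_ applies an operator to coefficients, and composition acts
  -- by successive application.
  vect-◇-∘ : ∀ X → IsVect X → ∀ P Q → (X ◇ P) ∘ Q ≃ X ∘ (P ∘ Q)
  vect-◇-∘ X vX P Q = ≃-trans (≃-cong (∘-linearˡ Q) (vect-◇ X vX P))
    (vect-ext
      (∘-linear (∘-linearˡ Q) (++-linear (•-linearˡ P) (∘-linearˡ P)))
      (∘-linearˡ (P ∘ Q))
      (λ u i → let X = ⟦ u , unit i ⟧ in terms-ext
        (∘-linear (∘-linearˡ Q) (++-linear (•-linearʳ X) (∘-linearʳ X)))
        (∘-linear (∘-linearʳ X) (∘-linearˡ Q))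
        (λ s → terms-ext
          (∘-linearʳ (X • ⟦ s ⟧ ++ X ∘ ⟦ s ⟧))
          (∘-linear (∘-linearʳ X) (∘-linearʳ ⟦ s ⟧))
          (on-terms u i s) Q) P) X vX)
    where
    on-terms : ∀ u i s t → let X = ⟦ u , unit i ⟧ in
      (X • ⟦ s ⟧ ++ X ∘ ⟦ s ⟧) ∘ ⟦ t ⟧ ≃ X ∘ (⟦ s ⟧ ∘ ⟦ t ⟧)
    on-terms u i (v , α) (w , β)
      rewrite ∂^-unit i v | ∂^-unit i (v * ∂^ α w) = ≃-trans (≃-sym (term-+ _ _ β))
        (term-cong (begin
          (u * v) * ∂^ (unit i +ᵐ α) w + (u * ∂ i v) * ∂^ α w
            ≈⟨ +-cong (trans (*-congˡ (∂^-unit-+ i α w)) (*-assoc u v _)) (*-assoc u _ _) ⟩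
          u * (v * ∂ i (∂^ α w)) + u * (∂ i v * ∂^ α w)
            ≈⟨ +-comm _ _ ⟩
          u * (∂ i v * ∂^ α w) + u * (v * ∂ i (∂^ α w))
            ≈⟨ distribˡ u _ _ ⟨
          u * (∂ i v * ∂^ α w + v * ∂ i (∂^ α w))
            ≈⟨ *-congˡ (∂-leibniz i v (∂^ α w)) ⟨
          u * ∂ i (v * ∂^ α w) ∎) ≡.refl)

  vect-∘-1 : ∀ X → IsVect X → X ∘ 1ᴰ ≃ []
  vect-∘-1 = vect-ext (∘-linearˡ 1ᴰ) []-linear λ u i →
    term-0 0ᵐ (trans (*-congˡ (trans (reflexive (∂^-unit i 1#)) (∂-1 i))) (zeroʳ u))

  1-∘ : ∀ P → 1ᴰ ∘ P ≃ P
  1-∘ = terms-ext (∘-linearʳ 1ᴰ) id-linear λ (u , α) →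
    term-cong (trans (*-identityˡ _) (reflexive (∂^-0 u))) ≡.refl

-- Composites of first-order operators

module CompositeExpansion {c ℓ a b} {K : CommutativeRing c ℓ} {n : ℕ} (D : DifferentialAlgebra K n a b) where
  open DifferentialOperators D
  open DiffAlgebra D
  open Linear
  open PartitionSums Diff-commutativeSemiring
  open Sums Diff-commutativeSemiring
  private module 𝔻 = CommutativeSemiring Diff-commutativeSemiring
  open import Relation.Binary.Reasoning.Setoid 𝔻.setoid

  -- For S with elements i₁ < ⋯ < iₛ, the composite map F iₛ … F i₁: the smallest
  -- index is applied first.
  compose : (Fin m → Diff → Diff) → Subset m → Diff → Diff
  compose F []            P = P
  compose F (outside ∷ S) P = compose (λ i → F (suc i)) S P
  compose F (inside  ∷ S) P = compose (λ i → F (suc i)) S (F zero P)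

  compose-linear : ∀ {F : Fin m → Diff → Diff} → (∀ i → Linear (F i)) → ∀ S → Linear (compose F S)
  compose-linear lF []            = id-linear
  compose-linear lF (outside ∷ S) = compose-linear (λ i → lF (suc i)) S
  compose-linear lF (inside  ∷ S) = ∘-linear (compose-linear (λ i → lF (suc i)) S) (lF zero)

  -- L iₛ ◇ ( ⋯ ◇ (L i₁ ◇ P)), and the same with _∘_.
  compose-◇ compose-∘ : (Fin m → Diff) → Subset m → Diff → Diff
  compose-◇ L = compose (λ i → L i ◇_)
  compose-∘ L = compose (λ i → L i ∘_)

  compose-◇-linear : (L : Fin m → Diff) → ∀ S → Linear (compose-◇ L S)
  compose-◇-linear L = compose-linear (λ i → ◇-linearʳ (L i))

  compose-∘-linear : (L : Fin m → Diff) → ∀ S → Linear (compose-∘ L S)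
  compose-∘-linear L = compose-linear (λ i → ∘-linearʳ (L i))

  -- In X ◇ (P • Q) the operator X is either composed with Q or applied to P.
  vect-◇-• : ∀ X → IsVect X → ∀ P Q → X ◇ (P • Q) ≃ P • (X ◇ Q) ++ (X ∘ P) • Q
  vect-◇-• X vX P Q = begin
    X ◇ (P • Q)
      ≈⟨ vect-◇ X vX (P • Q) ⟩
    X • (P • Q) ++ X ∘ (P • Q)
      ≈⟨ 𝔻.+-cong (x∙yz≈y∙xz X P Q)
                  (≃-trans (vect-∘-• X vX P Q) (++-comm ((X ∘ P) • Q) (P • (X ∘ Q)))) ⟩
    P • (X • Q) ++ (P • (X ∘ Q) ++ (X ∘ P) • Q)
      ≡⟨ ++-assoc (P • (X • Q)) _ _ ⟨
    (P • (X • Q) ++ P • (X ∘ Q)) ++ (X ∘ P) • Q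
      ≈⟨ 𝔻.+-congʳ (++-homo (•-linearʳ P) (X • Q) (X ∘ Q)) ⟨
    P • (X • Q ++ X ∘ Q) ++ (X ∘ P) • Q
      ≈⟨ 𝔻.+-congʳ (≃-cong (•-linearʳ P) (vect-◇ X vX Q)) ⟨
    P • (X ◇ Q) ++ (X ∘ P) • Q ∎
    where
    open import Algebra.Properties.CommutativeSemigroup 𝔻.*-commutativeSemigroup using (x∙yz≈y∙xz)

  -- Each factor of the composite is either applied to P (the indices in B) or
  -- composed with Q (the other indices).
  compose-◇-leibniz : (L : Fin m → Diff) → (∀ i → IsVect (L i)) → ∀ S P Q →
    compose-◇ L S (P • Q) ≃
      ∑ (λ B → guard (B ⊆? S) (compose-∘ L B P • compose-◇ L (S ─ B) Q)) (allSubsets m)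
  compose-◇-leibniz L vL [] P Q = ≃-reflexive (≡.sym (++-identityʳ (P • Q)))
  compose-◇-leibniz {suc m} L vL (s ∷ S) P Q = ≃-trans (by-head s) (≃-sym split)
    where
    L′ : Fin m → Diff
    L′ i = L (suc i)
    vL′ : ∀ i → IsVect (L′ i)
    vL′ i = vL (suc i)
    summand : ∀ s → Subset (suc m) → Diff
    summand s B = guard (B ⊆? (s ∷ S)) (compose-∘ L B P • compose-◇ L ((s ∷ S) ─ B) Q)
    -- The subsets of the larger set, according to whether they contain zero.
    split : ∑ (summand s) (allSubsets (suc m)) ≃
      ∑ (λ B → summand s (outside ∷ B)) (allSubsets m) ++ ∑ (λ B → summand s (inside ∷ B)) (allSubsets m)
    split = ≃-trans (∑-++ (summand s) (map (outside ∷_) (allSubsets m)) _)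
      (≃-reflexive (≡.cong₂ _++_ (∑-map (summand s) (outside ∷_) (allSubsets m))
                                 (∑-map (summand s) (inside ∷_) (allSubsets m))))
    by-head : ∀ s → compose-◇ L (s ∷ S) (P • Q) ≃
      ∑ (λ B → summand s (outside ∷ B)) (allSubsets m) ++ ∑ (λ B → summand s (inside ∷ B)) (allSubsets m)
    -- No subset of outside ∷ S contains zero, so the second sum vanishes.
    by-head outside = begin
      compose-◇ L′ S (P • Q)
        ≈⟨ compose-◇-leibniz L′ vL′ S P Q ⟩
      ∑ (λ B → summand outside (outside ∷ B)) (allSubsets m)
        ≡⟨ ++-identityʳ _ ⟨
      ∑ (λ B → summand outside (outside ∷ B)) (allSubsets m) ++ []
        ≈⟨ 𝔻.+-congˡ {∑ (λ B → summand outside (outside ∷ B)) (allSubsets m)} (∑-zero (allSubsets m)) ⟨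
      ∑ (λ B → summand outside (outside ∷ B)) (allSubsets m) ++ ∑ (λ B → summand outside (inside ∷ B)) (allSubsets m) ∎
    by-head inside = begin
      compose-◇ L′ S (L zero ◇ (P • Q))
        ≈⟨ ≃-cong (compose-◇-linear L′ S) (vect-◇-• (L zero) (vL zero) P Q) ⟩
      compose-◇ L′ S (P • (L zero ◇ Q) ++ (L zero ∘ P) • Q)
        ≈⟨ ++-homo (compose-◇-linear L′ S) (P • (L zero ◇ Q)) ((L zero ∘ P) • Q) ⟩
      compose-◇ L′ S (P • (L zero ◇ Q)) ++ compose-◇ L′ S ((L zero ∘ P) • Q)
        ≈⟨ 𝔻.+-cong (compose-◇-leibniz L′ vL′ S P (L zero ◇ Q))
                    (compose-◇-leibniz L′ vL′ S (L zero ∘ P) Q) ⟩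
      ∑ (λ B → summand inside (outside ∷ B)) (allSubsets m) ++ ∑ (λ B → summand inside (inside ∷ B)) (allSubsets m) ∎

  -- A composite acts by the successive action of its factors.
  compose-◇-∘ : (L : Fin m → Diff) → (∀ i → IsVect (L i)) → ∀ S P Q →
    compose-◇ L S P ∘ Q ≃ compose-∘ L S (P ∘ Q)
  compose-◇-∘ L vL []            P Q = ≃-refl
  compose-◇-∘ L vL (outside ∷ S) P Q = compose-◇-∘ (λ i → L (suc i)) (λ i → vL (suc i)) S P Q
  compose-◇-∘ L vL (inside  ∷ S) P Q = ≃-trans
    (compose-◇-∘ (λ i → L (suc i)) (λ i → vL (suc i)) S (L zero ◇ P) Q)
    (≃-cong (compose-∘-linear (λ i → L (suc i)) S) (vect-◇-∘ (L zero) (vL zero) P Q))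

  foldl-elements : (L : Fin m → Diff) (S : Subset m) (P : Diff) →
    foldl (λ Q X → X ◇ Q) P (map L (elements S)) ≡ compose-◇ L S P
  foldl-elements L []            P = ≡.refl
  foldl-elements L (outside ∷ S) P = ≡.trans
    (≡.cong (foldl _ P) (≡.trans (≡.cong (map L) (elements-outside S)) (≡.sym (map-∘ (elements S)))))
    (foldl-elements (λ i → L (suc i)) S P)
  foldl-elements L (inside  ∷ S) P = ≡.trans
    (≡.cong (foldl _ P) (≡.trans (≡.cong (map L) (elements-inside S))
                                 (≡.cong (L zero ∷_) (≡.sym (map-∘ (elements S))))))
    (foldl-elements (λ i → L (suc i)) S (L zero ◇ P))

  descending-elements : (L : Fin m → Diff) (S : Subset m) → descending L (elements S) ≡ compose-◇ L S 1ᴰ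
  descending-elements L S = ≡.trans (reverse-foldr _◇_ 1ᴰ (map L (elements S))) (foldl-elements L S 1ᴰ)

  descending-map-suc : (L : Fin (suc m) → Diff) (is : List (Fin m)) →
    descending L (map suc is) ≡ descending (λ i → L (suc i)) is
  descending-map-suc L is = ≡.cong (λ Xs → ◇-product (reverse Xs)) (≡.sym (map-∘ is))

  L-block-outside : (L : Fin (suc m) → Diff) (B : Subset m) →
    L-block L (outside ∷ B) ≡ L-block (λ i → L (suc i)) B
  L-block-outside L B = ≡.trans (≡.cong (nested L) (elements-outside B)) (nested-map-suc (elements B))
    where
    nested-map-suc : ∀ is → nested L (map suc is) ≡ nested (λ i → L (suc i)) is
    nested-map-suc []       = ≡.refl
    nested-map-suc (i ∷ is) = ≡.cong (_∘ L (suc i)) (descending-map-suc L is)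

  L-block-inside : (L : Fin (suc m) → Diff) → (∀ i → IsVect (L i)) → (B : Subset m) →
    L-block L (inside ∷ B) ≃ compose-∘ (λ i → L (suc i)) B (L zero)
  L-block-inside {m} L vL B = begin
    L-block L (inside ∷ B)
      ≡⟨ ≡.cong (nested L) (elements-inside B) ⟩
    descending L (map suc (elements B)) ∘ L zero
      ≡⟨ ≡.cong (_∘ L zero) (≡.trans (descending-map-suc L (elements B)) (descending-elements L′ B)) ⟩
    compose-◇ L′ B 1ᴰ ∘ L zero
      ≈⟨ compose-◇-∘ L′ vL′ B 1ᴰ (L zero) ⟩
    compose-∘ L′ B (1ᴰ ∘ L zero)
      ≈⟨ ≃-cong (compose-∘-linear L′ B) (1-∘ (L zero)) ⟩
    compose-∘ L′ B (L zero) ∎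
    where
    L′ : Fin m → Diff
    L′ i = L (suc i)
    vL′ : ∀ i → IsVect (L′ i)
    vL′ i = vL (suc i)

  -- The expansion for the operators with index in S.  If S contains zero, then
  -- the Leibniz rule for L zero • 1ᴰ sums over the block inside ∷ B of zero.
  compose-◇-partitions : (L : Fin m → Diff) → (∀ i → IsVect (L i)) → ∀ S →
    compose-◇ L S 1ᴰ ≃ partitionSum (L-block L) (allSubsets m) S
  -- The only partition of the empty set is empty, so both sides compute to 1ᴰ.
  compose-◇-partitions L vL [] = ≃-refl
  compose-◇-partitions {suc m} L vL (outside ∷ S) = begin
    compose-◇ L′ S 1ᴰ
      ≈⟨ compose-◇-partitions L′ vL′ S ⟩
    partitionSum (L-block L′) (allSubsets m) S
      ≡⟨ partitionSum-≗ (allSubsets m) S (L-block-outside L) ⟨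
    partitionSum (λ B → L-block L (outside ∷ B)) (allSubsets m) S
      ≈⟨ partitionSum-outside (L-block L) (allSubsets m) (allSubsets m) S ⟨
    partitionSum (L-block L) (allSubsets (suc m)) (outside ∷ S) ∎
    where
    L′ : Fin m → Diff
    L′ i = L (suc i)
    vL′ : ∀ i → IsVect (L′ i)
    vL′ i = vL (suc i)
  compose-◇-partitions {suc m} L vL (inside ∷ S) = begin
    compose-◇ L′ S (L zero ◇ 1ᴰ)
      ≈⟨ ≃-cong (compose-◇-linear L′ S) X◇1≃X•1 ⟩
    compose-◇ L′ S (L zero • 1ᴰ)
      ≈⟨ compose-◇-leibniz L′ vL′ S (L zero) 1ᴰ ⟩
    ∑ (λ B → guard (B ⊆? S) (compose-∘ L′ B (L zero) • compose-◇ L′ (S ─ B) 1ᴰ)) (allSubsets m)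
      ≈⟨ ∑-cong (allSubsets m) (λ B → guard-cong (B ⊆? S)
           (𝔻.*-cong (≃-sym (L-block-inside L vL B)) (rest (S ─ B)))) ⟩
    ∑ (λ B → guard (B ⊆? S)
        (L-block L (inside ∷ B) • partitionSum (λ A → L-block L (outside ∷ A)) (allSubsets m) (S ─ B)))
      (allSubsets m)
      ≈⟨ partitionSum-inside (L-block L) (allSubsets m) (allSubsets m) S ⟨
    partitionSum (L-block L) (allSubsets (suc m)) (inside ∷ S) ∎
    where
    L′ : Fin m → Diff
    L′ i = L (suc i)
    vL′ : ∀ i → IsVect (L′ i)
    vL′ i = vL (suc i)
    X◇1≃X•1 : L zero ◇ 1ᴰ ≃ L zero • 1ᴰ
    X◇1≃X•1 = ≃-trans (vect-◇ (L zero) (vL zero) 1ᴰ)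
      (≃-trans (𝔻.+-congˡ (vect-∘-1 (L zero) (vL zero))) (𝔻.+-identityʳ _))
    rest : ∀ T → compose-◇ L′ T 1ᴰ ≃ partitionSum (λ A → L-block L (outside ∷ A)) (allSubsets m) T
    rest T = ≃-trans (compose-◇-partitions L′ vL′ T)
      (≃-reflexive (≡.sym (partitionSum-≗ (allSubsets m) T (L-block-outside L))))

theorem4 : ∀ {c ℓ a b : Level} (K : CommutativeRing c ℓ) (n : ℕ) (D : DifferentialAlgebra K n a b) →
    let open DifferentialOperators D in
    (m : ℕ) → 1 ≤ m → (L : Fin m → Diff) → (∀ i → IsVect (L i)) →
    descending L (allFin m) ≋ sumᴰ (map (L-partition L) (setPartitions m))
theorem4 K n D m _ L vL = _≃_.coeffs (≃-trans
  (≃-reflexive (≡.trans (≡.cong (descending L) (≡.sym (elements-⊤ m))) (descending-elements L ⊤)))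
  (compose-◇-partitions L vL ⊤))
  where
  open DifferentialOperators D
  open DiffAlgebra D
  open CompositeExpansion D
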